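{- For every fixed integer $s \ge 1$, there are only finitely many (up to isomorphism) $5$-vertex-critical $(P_5, K_{1,s}+P_1)$-free graphs.
   Context: All graphs are finite, simple and undirected. $P_t$ denotes the path on $t$ vertices, $K_{1,s}$ the star with $s$ leaves, and $G+H$ the disjoint union of graphs $G$ and $H$ (so $K_{1,s}+P_1$ is the disjoint union of $K_{1,s}$ and an isolated vertex). A graph is $(H_1,H_2)$-free if it contains no induced subgraph isomorphic to $H_1$ or to $H_2$. A graph $G$ is $k$-vertex-critical if $\chi(G)=k$ and $\chi(G-v)<k$ for every vertex $v\in V(G)$, where $\chi$ is the chromatic number. -}

module Defs where

open import Data.Nat using (ℕ; zero; suc; _+_; _<_; _≤ᵇ_; _≡ᵇ_; pred)
open import Data.Bool using (Bool; true; false; _∧_; _∨_)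
open import Data.Bool.Properties using (∨-comm)
open import Data.Fin using (Fin; toℕ; punchIn)
open import Data.Product using (Σ; _×_; _,_; ∃)
open import Data.List using (List)
open import Data.List.Membership.Propositional using (_∈_)
open import Function.Definitions using (Injective)
open import Function.Bundles using (_↔_; Inverse)
open import Relation.Binary.PropositionalEquality using (_≡_; _≢_; refl)
open import Relation.Nullary using (¬_)

record Graph (n : ℕ) : Set where
  field
    adj    : Fin n → Fin n → Bool
    sym    : ∀ i j → adj i j ≡ adj j i
    irrefl : ∀ i → adj i i ≡ false
open Graph public

AnyGraph : Set
AnyGraph = Σ ℕ Graph

InducedSub : ∀ {m n} → Graph m → Graph n → Set
InducedSub {m} {n} H G =
  Σ (Fin m → Fin n) λ f → Injective _≡_ _≡_ f × (∀ i j → adj G (f i) (f j) ≡ adj H i j)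

Free₂ : ∀ {a b n} → Graph a → Graph b → Graph n → Set
Free₂ H₁ H₂ G = ¬ InducedSub H₁ G × ¬ InducedSub H₂ G

Iso : ∀ {m n} → Graph m → Graph n → Set
Iso {m} {n} G H =
  Σ (Fin m ↔ Fin n) λ φ → ∀ i j → adj H (Inverse.to φ i) (Inverse.to φ j) ≡ adj G i j

Colorable : ∀ {n} → Graph n → ℕ → Set
Colorable {n} G k =
  Σ (Fin n → Fin k) λ c → ∀ i j → adj G i j ≡ true → c i ≢ c j

HasChromaticNumber : ∀ {n} → Graph n → ℕ → Set
HasChromaticNumber G k = Colorable G k × (∀ j → j < k → ¬ Colorable G j)

deleteVertex : ∀ {n} → Graph n → Fin n → Graph (pred n)
deleteVertex {suc n} G v = record
  { adj    = λ i j → adj G (punchIn v i) (punchIn v j)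
  ; sym    = λ i j → sym G (punchIn v i) (punchIn v j)
  ; irrefl = λ i → irrefl G (punchIn v i)
  }

VertexCritical : ℕ → ∀ {n} → Graph n → Set
VertexCritical k {n} G =
  HasChromaticNumber G k ×
  (∀ (v : Fin n) → ∃ λ j → j < k × HasChromaticNumber (deleteVertex G v) j)

mkGraph : (n : ℕ) (r : ℕ → ℕ → Bool) →
          (∀ a b → r a b ≡ r b a) → (∀ a → r a a ≡ false) → Graph n
mkGraph n r s i = record
  { adj    = λ x y → r (toℕ x) (toℕ y)
  ; sym    = λ x y → s (toℕ x) (toℕ y)
  ; irrefl = λ x → i (toℕ x)
  }

pathRel : ℕ → ℕ → Bool
pathRel a b = (suc a ≡ᵇ b) ∨ (suc b ≡ᵇ a)

private
  suc≢ᵇ : ∀ a → (suc a ≡ᵇ a) ≡ false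
  suc≢ᵇ zero = refl
  suc≢ᵇ (suc a) = suc≢ᵇ a

  pathIrrefl : ∀ a → pathRel a a ≡ false
  pathIrrefl a rewrite suc≢ᵇ a = refl

P : (t : ℕ) → Graph t
P t = mkGraph t pathRel (λ a b → ∨-comm (suc a ≡ᵇ b) (suc b ≡ᵇ a)) pathIrrefl

-- K_{1,s} + P_1 on vertices 0,…,s+1: centre 0, leaves 1,…,s, isolated s+1.
isLeaf : ℕ → ℕ → Bool
isLeaf s b = (1 ≤ᵇ b) ∧ (b ≤ᵇ s)

starRel : ℕ → ℕ → ℕ → Bool
starRel s a b = ((a ≡ᵇ 0) ∧ isLeaf s b) ∨ ((b ≡ᵇ 0) ∧ isLeaf s a)

private
  starIrrefl : ∀ s a → starRel s a a ≡ false
  starIrrefl s zero = refl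
  starIrrefl s (suc a) = refl

K1s+P1 : (s : ℕ) → Graph (s + 2)
K1s+P1 s = mkGraph (s + 2) (starRel s)
  (λ a b → ∨-comm ((a ≡ᵇ 0) ∧ isLeaf s b) ((b ≡ᵇ 0) ∧ isLeaf s a))
  (starIrrefl s)

FinitelyManyUpToIso : (∀ {n} → Graph n → Set) → Set
FinitelyManyUpToIso 𝒞 =
  Σ (List AnyGraph) λ L →
    ∀ {n} (G : Graph n) → 𝒞 G → Σ AnyGraph λ H → H ∈ L × Iso G (Data.Product.proj₂ H)

{-# OPTIONS --safe #-}
-- Fix a proper 5-colouring c of G.  If x and u are nonadjacent, then each colour class meets
-- N(x) ∖ N(u) in fewer than s vertices, since otherwise x, s of these vertices and u induce
-- K_{1,s} + P₁.  A shortest path in the complement of G has every second vertex in a clique of G,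
-- so any two vertices of a component D of the complement have bounded distance there, and N(w) ∖ N(y)
-- is bounded for all w, y ∈ D.  For y ∈ N(w) ∩ D of a given colour, all vertices of that colour
-- lie outside N(y), so G[D] has bounded degree.  Criticality makes G[D] connected, because D is
-- complete to the rest of G; as G is P₅-free, G[D] has radius at most 3 and D is bounded.
-- Finally every colour class lies in a single D.
module Submission where

open import Defs
open import Data.Bool using (Bool; true; false; _∧_; not; T)
import Data.Bool as Bool
open import Data.Bool.Properties using (¬-not; ∨-identityʳ; ∧-comm; ∧-idem; ∧-zeroʳ; ∧-identityʳ)
open import Data.Empty using (⊥-elim)
open import Data.Fin using (Fin; zero; suc; toℕ; fromℕ<; inject≤; punchOut; _≟_)
open import Data.Fin.Properties
  using (any?; all?; pigeonhole; injective⇒≤; inject≤-injective; punchIn-punchOut;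
         toℕ<n; toℕ-injective; fromℕ<-injective)
open import Data.List
  using (List; []; _∷_; _++_; length; map; concatMap; filter; allFin; lookup; upTo; cartesianProductWith)
open import Data.List.Properties using (length-++; length-tabulate)
open import Data.List.Membership.Propositional using (_∈_; lose)
open import Data.List.Membership.Propositional.Properties
  using (∈-filter⁺; ∈-filter⁻; ∈-allFin; ∈-++⁺ˡ; ∈-++⁺ʳ; ∈-concatMap⁺; ∈-upTo⁺; ∈-map⁺;
         ∈-cartesianProductWith⁺; ∈-lookup)
open import Data.List.Membership.Setoid.Properties using (index-injective)
open import Data.List.Relation.Unary.All using (All; []; _∷_)
import Data.List.Relation.Unary.All as All
open import Data.List.Relation.Unary.Any using (here; there; index)
open import Data.List.Relation.Unary.AllPairs using ([]; _∷_)
open import Data.List.Relation.Unary.Unique.Propositional using (Unique)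
open import Data.List.Relation.Unary.Unique.Propositional.Properties using (allFin⁺; filter⁺)
open import Data.Nat using (ℕ; zero; suc; _+_; _*_; _∸_; _^_; _≤_; _<_; z≤n; s≤s; _<?_; _≤?_; _<ᵇ_; _≡ᵇ_)
open import Data.Nat.Properties
  using (≤-refl; ≤-reflexive; ≤-trans; <⇒≤; <-≤-trans; m≤n⇒m≤1+n; n<1+n; m≤n+m; +-mono-≤; +-comm;
         *-comm; *-monoˡ-≤; m∸n≤m; <-cmp; ≰⇒>; ≮⇒≥; <⇒≢; ≡⇒≡ᵇ; ≡ᵇ⇒≡; <⇒<ᵇ; <ᵇ⇒<;
         ≤-antisym; ≤-pred; ∸-monoʳ-<; <-irrefl)
open import Data.Product using (Σ; ∃-syntax; _×_; _,_; proj₁; proj₂)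
open import Data.Sum using (_⊎_; inj₁; inj₂)
open import Data.Unit using (⊤; tt)
open import Data.Vec using (Vec; []; _∷_)
import Data.Vec as Vec
open import Data.Vec.Properties using (lookup∘tabulate)
open import Function using (_∘_; id)
open import Function.Construct.Identity using (↔-id)
open import Function.Definitions using (Injective)
open import Relation.Binary using (tri<; tri≈; tri>)
open import Relation.Binary.PropositionalEquality
  using (_≡_; _≢_; refl; trans; cong; cong₂; subst; setoid; ≢-sym)
import Relation.Binary.PropositionalEquality as ≡
open import Relation.Nullary using (¬_; Dec; yes; no; contradiction; does)
open import Relation.Nullary.Decidable using (_×-dec_; _⊎-dec_; _→-dec_; ¬?; decidable-stable; dec-true; dec-false)
open import Relation.Unary using (Decidable)

-- Booleans and truth values.

T⇒≡true : ∀ {b} → T b → b ≡ true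
T⇒≡true {true} _ = refl

¬T⇒≡false : ∀ {b} → ¬ T b → b ≡ false
¬T⇒≡false {false} _  = refl
¬T⇒≡false {true}  ¬t = ⊥-elim (¬t tt)

true≢false : ∀ {b} → b ≡ true → b ≢ false
true≢false refl ()

-- Finite covers of predicates

-- An upper bound on the cardinality of `P` that avoids counting: the list may repeat entries and
-- contain non-members, so unions are concatenations and `P` need not be decidable.
record Covered {n} (P : Fin n → Set) (b : ℕ) : Set where
  constructor cover
  field
    members  : List (Fin n)
    bounded  : length members ≤ b
    complete : ∀ {x} → P x → x ∈ members

Covered-⊤ : ∀ {n} → Covered {n} (λ _ → ⊤) n
Covered-⊤ {n} = cover (allFin n) (≤-reflexive (length-tabulate id)) (λ {x} _ → ∈-allFin x)

module _ {n : ℕ} where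

  Covered-mono : ∀ {P Q : Fin n → Set} {a b} → (∀ {x} → P x → Q x) → a ≤ b → Covered Q a → Covered P b
  Covered-mono P⊆Q a≤b (cover xs l h) = cover xs (≤-trans l a≤b) (h ∘ P⊆Q)

  Covered-⊆ : ∀ {P Q : Fin n → Set} {b} → (∀ {x} → P x → Q x) → Covered Q b → Covered P b
  Covered-⊆ P⊆Q = Covered-mono P⊆Q ≤-refl

  Covered-∅ : ∀ {P : Fin n → Set} {b} → (∀ {x} → ¬ P x) → Covered P b
  Covered-∅ ¬P = cover [] z≤n (⊥-elim ∘ ¬P)

  Covered-∪ : ∀ {P Q : Fin n → Set} {a b} → Covered P a → Covered Q b → Covered (λ x → P x ⊎ Q x) (a + b)
  Covered-∪ {P} {Q} (cover xs lx hx) (cover ys ly hy) = cover (xs ++ ys)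
    (≤-trans (≤-reflexive (length-++ xs)) (+-mono-≤ lx ly)) h
    where
    h : ∀ {x} → P x ⊎ Q x → x ∈ xs ++ ys
    h (inj₁ p) = ∈-++⁺ˡ (hx p)
    h (inj₂ q) = ∈-++⁺ʳ xs (hy q)

  Covered-⋃ : ∀ {k a b} {I : Fin k → Set} {Q : Fin k → Fin n → Set} →
              Covered I a → (∀ i → Covered (Q i) b) → Covered (λ x → ∃[ i ] I i × Q i x) (a * b)
  Covered-⋃ {a = a} {b} {I} {Q} (cover is l h) Qs = cover (concatMap mem is)
    (≤-trans (length-bound is) (*-monoˡ-≤ b l))
    λ (i , Ii , Qix) → ∈-concatMap⁺ mem (lose (h Ii) (Covered.complete (Qs i) Qix))
    where
    mem : Fin _ → List (Fin n)
    mem i = Covered.members (Qs i)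
    length-bound : ∀ js → length (concatMap mem js) ≤ length js * b
    length-bound []       = z≤n
    length-bound (j ∷ js) = ≤-trans (≤-reflexive (length-++ (mem j)))
                                    (+-mono-≤ (Covered.bounded (Qs j)) (length-bound js))

  Covered-fibres : ∀ {k b} {P : Fin n → Set} (c : Fin n → Fin k) →
                   (∀ i → Covered (λ x → P x × c x ≡ i) b) → Covered P (k * b)
  Covered-fibres {k} c fibres =
    Covered-⊆ (λ {x} p → c x , tt , p , refl) (Covered-⋃ Covered-⊤ fibres)

  -- For bounds whose proof needs a member `w` of `P` to compare the others with. The bound must not
  -- depend on `w`.
  Covered-inhabited : ∀ {b} {P : Fin n → Set} → Decidable P → (∀ w → P w → Covered P b) → Covered P b
  Covered-inhabited P? h with any? P?
  ... | yes (w , Pw) = h w Pw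
  ... | no  ¬∃       = Covered-∅ (λ {x} Px → ¬∃ (x , Px))

  lookup-injective : ∀ {xs : List (Fin n)} → Unique xs → Injective _≡_ _≡_ (lookup xs)
  lookup-injective (_ ∷ _)  {zero}  {zero}  _ = refl
  lookup-injective (x∉ ∷ _) {zero}  {suc j} e = contradiction e (All.lookup x∉ (∈-lookup j))
  lookup-injective (x∉ ∷ _) {suc i} {zero}  e = contradiction (≡.sym e) (All.lookup x∉ (∈-lookup i))
  lookup-injective (_ ∷ u)  {suc i} {suc j} e = cong suc (lookup-injective u e)

  -- If the repetition-free list of all elements of `P` were longer than `b`, its first `b` entries
  -- would be a forbidden injection.
  Covered-no-injection : ∀ {b} {P : Fin n → Set} → Decidable P →
    (∀ (ℓ : Fin b → Fin n) → Injective _≡_ _≡_ ℓ → ¬ (∀ i → P (ℓ i))) → Covered P b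
  Covered-no-injection {b} {P} P? none with length (filter P? (allFin n)) ≤? b
  ... | yes l = cover (filter P? (allFin n)) l (λ {x} → ∈-filter⁺ P? (∈-allFin x))
  ... | no ¬l = ⊥-elim (none (λ i → lookup xs (inject≤ i b≤))
                  (λ e → inject≤-injective b≤ b≤ _ _ (lookup-injective (filter⁺ P? (allFin⁺ n)) e))
                  (λ i → proj₂ (∈-filter⁻ P? {xs = allFin n} (∈-lookup {xs = xs} (inject≤ i b≤)))))
    where
    xs = filter P? (allFin n)
    b≤ : b ≤ length xs
    b≤ = <⇒≤ (≰⇒> ¬l)

  -- Sending each vertex to its position in the covering list is injective.
  Covered-⊤⇒≤ : ∀ {b} → Covered {n} (λ _ → ⊤) b → n ≤ b
  Covered-⊤⇒≤ (cover xs l h) =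
    ≤-trans (injective⇒≤ {f = λ x → index (h {x} tt)}
              (λ {x} {y} → index-injective (setoid _) (h {x} tt) (h {y} tt))) l

-- Balls and geodesics

module Balls {n} {R : Fin n → Fin n → Set} (R? : ∀ x y → Dec (R x y)) (v : Fin n) where

  Ball : ℕ → Fin n → Set
  Ball zero    x = x ≡ v
  Ball (suc k) x = Ball k x ⊎ ∃[ y ] Ball k y × R y x

  Ball? : ∀ k → Decidable (Ball k)
  Ball? zero    x = x ≟ v
  Ball? (suc k) x = Ball? k x ⊎-dec any? (λ y → Ball? k y ×-dec R? y x)

  Ball-mono : ∀ {i j x} → i ≤ j → Ball i x → Ball j x
  Ball-mono {j = zero}  z≤n     b = b
  Ball-mono {j = suc j} z≤n     b = inj₁ (Ball-mono (z≤n {j}) b)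
  Ball-mono (s≤s i≤j) (inj₁ b)           = inj₁ (Ball-mono i≤j b)
  Ball-mono (s≤s i≤j) (inj₂ (y , b , r)) = inj₂ (y , Ball-mono i≤j b , r)

  -- A shortest path of length k, traversed towards v.
  record Geodesic (k : ℕ) : Set where
    field
      at       : ℕ → Fin n
      level    : ∀ {i} → i ≤ k → Ball (k ∸ i) (at i)
      step     : ∀ {i} → i < k → R (at (suc i)) (at i)
      far      : ∀ {i j} → suc i < j → j ≤ k → ¬ R (at j) (at i)
      distinct : ∀ {i j} → i < j → j ≤ k → at i ≢ at j

  -- Induction on `k`: the predecessor `y` of `x` is in no ball of radius below `k`, or `x` would be
  -- reached too early. Likewise a shortcut to `x` from position `j` of the path from `y`, with
  -- `0 < j`, would put `x` in the ball of radius `suc (k ∸ j)`, which is at most `k`.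
  geodesic : ∀ k {x} → Ball k x → (∀ {j} → j < k → ¬ Ball j x) → Σ (Geodesic k) λ γ → Geodesic.at γ 0 ≡ x
  geodesic zero {x} b _ = record
    { at = λ _ → x ; level = λ { z≤n → b } ; step = λ () ; far = λ { () z≤n } ; distinct = λ { () z≤n } } , refl
  geodesic (suc k) (inj₁ b) out = contradiction b (out (n<1+n k))
  geodesic (suc k) {x} (inj₂ (y , b , r)) out
    with γ , refl ← geodesic k b (λ j<k b′ → out (s≤s j<k) (inj₂ (y , b′ , r))) = record
    { at = p ; level = level′ ; step = step′ ; far = far′ ; distinct = distinct′ } , refl
    where
    open Geodesic γ
    p : ℕ → Fin n
    p zero    = x
    p (suc i) = at i
    level′ : ∀ {i} → i ≤ suc k → Ball (suc k ∸ i) (p i)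
    level′ {zero}  _         = inj₂ (at 0 , b , r)
    level′ {suc i} (s≤s i≤k) = level i≤k
    step′ : ∀ {i} → i < suc k → R (p (suc i)) (p i)
    step′ {zero}  _         = r
    step′ {suc i} (s≤s i<k) = step i<k
    far′ : ∀ {i j} → suc i < j → j ≤ suc k → ¬ R (p j) (p i)
    far′ {zero} {suc j} (s≤s 0<j) (s≤s j≤k) r′ =
      out (s≤s (∸-monoʳ-< 0<j j≤k)) (inj₂ (at j , level j≤k , r′))
    far′ {suc i} {suc j} (s≤s i<j) (s≤s j≤k) = far i<j j≤k
    distinct′ : ∀ {i j} → i < j → j ≤ suc k → p i ≢ p j
    distinct′ {zero}  {suc j} _         (s≤s j≤k) e =
      out (s≤s (m∸n≤m k j)) (subst (Ball (k ∸ j)) (≡.sym e) (level j≤k))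
    distinct′ {suc i} {suc j} (s≤s i<j) (s≤s j≤k)   = distinct i<j j≤k

  -- If `y` were outside the ball, it would be at distance exactly `suc r`, and a shortest path to
  -- it would be a geodesic of that length.
  Ball-closed : ∀ {r} → ¬ Geodesic (suc r) → ∀ {x y} → Ball r x → R x y → Ball r y
  Ball-closed {r} none {x} {y} b Rxy = decidable-stable (Ball? r y) λ ¬b →
    none (proj₁ (geodesic (suc r) (inj₂ (x , b , Rxy)) λ { (s≤s j≤r) → ¬b ∘ Ball-mono j≤r }))

-- Colourings

proper : ∀ {n k} → Graph n → (Fin n → Fin k) → Set
proper G c = ∀ x y → adj G x y ≡ true → c x ≢ c y

Colorable-mono : ∀ {n j k} {G : Graph n} → j ≤ k → Colorable G j → Colorable G k
Colorable-mono j≤k (c , pr) = (λ x → inject≤ (c x) j≤k) ,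
  λ x y a e → pr x y a (inject≤-injective j≤k j≤k _ _ e)

-- Puts colourings of different vertex-deleted graphs on the common vertex set `Fin n`. The colour
-- `d` at `v` is a filler, so properness is claimed only away from `v`.
undelete : ∀ {n k} (G : Graph n) (v : Fin n) → Fin k → Colorable (deleteVertex G v) k →
           Σ (Fin n → Fin k) λ c → ∀ x y → v ≢ x → v ≢ y → adj G x y ≡ true → c x ≢ c y
undelete {suc n} {k} G v d (c , pr) = c′ , pr′
  where
  c′ : Fin (suc n) → Fin k
  c′ x with v ≟ x
  ... | yes _  = d
  ... | no v≢x = c (punchOut v≢x)
  pr′ : ∀ x y → v ≢ x → v ≢ y → adj G x y ≡ true → c′ x ≢ c′ y
  pr′ x y v≢x v≢y a with v ≟ x | v ≟ y
  ... | yes e | _     = contradiction e v≢x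
  ... | no _  | yes e = contradiction e v≢y
  ... | no p  | no q  = pr _ _ (trans (cong₂ (adj G) (punchIn-punchOut p) (punchIn-punchOut q)) a)

-- Comparing sizes of sets of colours.

InjectsInto : ∀ {k} → (Fin k → Set) → (Fin k → Set) → Set
InjectsInto {k} A B = Σ (Fin k → Fin k) λ g →
  (∀ {a} → A a → B (g a)) × (∀ {a b} → A a → A b → g a ≡ g b → a ≡ b)

InjectsInto-∷ : ∀ {k} {x y} {xs ys : List (Fin k)} → All (x ≢_) xs → All (y ≢_) ys →
                InjectsInto (_∈ xs) (_∈ ys) → InjectsInto (_∈ x ∷ xs) (_∈ y ∷ ys)
InjectsInto-∷ {k} {x} {y} {xs} {ys} x∉ y∉ (g , into , inj) = g′ , into′ , inj′
  where
  g′ : Fin k → Fin k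
  g′ z with z ≟ x
  ... | yes _ = y
  ... | no  _ = g z
  tail : ∀ {z} → z ≢ x → z ∈ x ∷ xs → z ∈ xs
  tail z≢x (here e)  = contradiction e z≢x
  tail z≢x (there m) = m
  into′ : ∀ {z} → z ∈ x ∷ xs → g′ z ∈ y ∷ ys
  into′ {z} m with z ≟ x
  ... | yes _  = here refl
  ... | no z≢x = there (into (tail z≢x m))
  inj′ : ∀ {a b} → a ∈ x ∷ xs → b ∈ x ∷ xs → g′ a ≡ g′ b → a ≡ b
  inj′ {a} {b} ma mb e with a ≟ x | b ≟ x
  ... | yes refl | yes refl = refl
  ... | yes refl | no q     = contradiction e (All.lookup y∉ (into (tail q mb)))
  ... | no p     | yes refl = contradiction (≡.sym e) (All.lookup y∉ (into (tail p ma)))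
  ... | no p     | no q     = inj (tail p ma) (tail q mb) e

-- Heads are paired off until one list runs out; the exhausted list injects vacuously.
lists-comparable : ∀ {k} {xs ys : List (Fin k)} → Unique xs → Unique ys →
                   InjectsInto (_∈ xs) (_∈ ys) ⊎ InjectsInto (_∈ ys) (_∈ xs)
lists-comparable {xs = []} _ _ = inj₁ (id , (λ ()) , λ ())
lists-comparable {xs = _ ∷ _} {[]} _ _ = inj₂ (id , (λ ()) , λ ())
lists-comparable {xs = x ∷ xs} {y ∷ ys} (x∉ ∷ ux) (y∉ ∷ uy) with lists-comparable ux uy
... | inj₁ g = inj₁ (InjectsInto-∷ x∉ y∉ g)
... | inj₂ g = inj₂ (InjectsInto-∷ y∉ x∉ g)

InjectsInto-filter : ∀ {k} {A B : Fin k → Set} (A? : Decidable A) (B? : Decidable B) →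
  InjectsInto (_∈ filter A? (allFin k)) (_∈ filter B? (allFin k)) → InjectsInto A B
InjectsInto-filter {k} A? B? (g , into , inj) = g ,
  (λ a → proj₂ (∈-filter⁻ B? {xs = allFin k} (into (∈-filter⁺ A? (∈-allFin _) a)))) ,
  (λ a b → inj (∈-filter⁺ A? (∈-allFin _) a) (∈-filter⁺ A? (∈-allFin _) b))

sets-comparable : ∀ {k} {A B : Fin k → Set} → Decidable A → Decidable B → InjectsInto A B ⊎ InjectsInto B A
sets-comparable {k} A? B? with lists-comparable (filter⁺ A? (allFin⁺ k)) (filter⁺ B? (allFin⁺ k))
... | inj₁ g = inj₁ (InjectsInto-filter A? B? g)
... | inj₂ g = inj₂ (InjectsInto-filter B? A? g)

-- Recolouring part of a graph.

module _ {n k : ℕ} (G : Graph n) where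

  glue : ∀ {E : Fin n → Set} → Decidable E → (c₁ c₂ : Fin n → Fin k) →
         (∀ {x y} → E x → E y → adj G x y ≡ true → c₁ x ≢ c₁ y) →
         (∀ {x y} → ¬ E x → ¬ E y → adj G x y ≡ true → c₂ x ≢ c₂ y) →
         (∀ {x y} → E x → ¬ E y → adj G x y ≡ true → c₁ x ≢ c₂ y) →
         Colorable G k
  glue {E} E? c₁ c₂ p₁ p₂ p₁₂ = c , pr
    where
    c : Fin n → Fin k
    c x with E? x
    ... | yes _ = c₁ x
    ... | no  _ = c₂ x
    pr : proper G c
    pr x y a with E? x | E? y
    ... | yes p | yes q = p₁ p q a
    ... | yes p | no  q = p₁₂ p q a
    ... | no  p | yes q = ≢-sym (p₁₂ q p (trans (sym G y x) a))
    ... | no  p | no  q = p₂ p q a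

  -- Otherwise colour G − y and G − v.  Both colourings reserve for D the colours unused outside D;
  -- one reserved palette injects into the other, and moving the part of D coloured from the
  -- smaller palette into the larger one colours all of G.
  module-connected : ∀ {D E : Fin n → Set} → Decidable D → Decidable E → Fin k →
    ¬ Colorable G k → (∀ v → Colorable (deleteVertex G v) k) →
    (∀ {x} → E x → D x) →
    (∀ {x y} → D x → ¬ D y → adj G x y ≡ true) →
    (∀ {x y} → E x → D y → adj G x y ≡ true → E y) →
    ∀ {v y} → E v → D y → E y
  module-connected {D} {E} D? E? d ¬col col- E⊆D complete closed {v} {y} Ev Dy =
    decidable-stable (E? y) λ ¬Ey → ¬col (colouring ¬Ey)
    where
    colouring : ¬ E y → Colorable G k
    -- `c₁` can fail only at `y`, which lies in `F`, and `c₂` only at `v`, which lies in `E`. So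
    -- `c₁` is proper off `F` and `c₂` off `E`.
    colouring ¬Ey with c₁ , pr₁ ← undelete G y d (col- y) | c₂ , pr₂ ← undelete G v d (col- v)
      = result (sets-comparable (Reserved? c₁) (Reserved? c₂))
      where
      Reserved : (Fin n → Fin k) → Fin k → Set
      Reserved c a = ∀ x → ¬ D x → a ≢ c x
      Reserved? : ∀ c → Decidable (Reserved c)
      Reserved? c a = all? λ x → ¬? (D? x) →-dec ¬? (a ≟ c x)
      F : Fin n → Set
      F x = D x × ¬ E x
      F? : Decidable F
      F? x = D? x ×-dec ¬? (E? x)
      ¬F⇒≢y : ∀ {x} → ¬ F x → y ≢ x
      ¬F⇒≢y ¬Fx refl = ¬Fx (Dy , ¬Ey)
      ¬E⇒≢v : ∀ {x} → ¬ E x → v ≢ x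
      ¬E⇒≢v ¬Ex refl = ¬Ex Ev
      E⇒¬F : ∀ {x} → E x → ¬ F x
      E⇒¬F Ex (_ , ¬Ex) = ¬Ex Ex
      -- The vertices of `D` see everything outside `D`, so the colours on `E` do not recur there.
      reserved₁ : ∀ {x} → E x → Reserved c₁ (c₁ x)
      reserved₁ Ex z ¬Dz = pr₁ _ z (¬F⇒≢y (E⇒¬F Ex)) (¬F⇒≢y (¬Dz ∘ proj₁)) (complete (E⊆D Ex) ¬Dz)
      reserved₂ : ∀ {x} → F x → Reserved c₂ (c₂ x)
      reserved₂ (Dx , ¬Ex) z ¬Dz = pr₂ _ z (¬E⇒≢v ¬Ex) (¬E⇒≢v (¬Dz ∘ E⊆D)) (complete Dx ¬Dz)
      result : InjectsInto (Reserved c₁) (Reserved c₂) ⊎ InjectsInto (Reserved c₂) (Reserved c₁) → Colorable G k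
      result (inj₁ (g , into , inj)) = glue E? (g ∘ c₁) c₂
        (λ Ex Ez a e → pr₁ _ _ (¬F⇒≢y (E⇒¬F Ex)) (¬F⇒≢y (E⇒¬F Ez)) a (inj (reserved₁ Ex) (reserved₁ Ez) e))
        (λ ¬Ex ¬Ez → pr₂ _ _ (¬E⇒≢v ¬Ex) (¬E⇒≢v ¬Ez))
        (λ Ex ¬Ez a → into (reserved₁ Ex) _ (λ Dz → ¬Ez (closed Ex Dz a)))
      result (inj₂ (g , into , inj)) = glue F? (g ∘ c₂) c₁
        (λ Fx Fz a e → pr₂ _ _ (¬E⇒≢v (proj₂ Fx)) (¬E⇒≢v (proj₂ Fz)) a (inj (reserved₂ Fx) (reserved₂ Fz) e))
        (λ ¬Fx ¬Fz → pr₁ _ _ (¬F⇒≢y ¬Fx) (¬F⇒≢y ¬Fz))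
        (λ {x} {z} Fx ¬Fz a → into (reserved₂ Fx) z λ Dz →
           ¬Fz (Dz , λ Ez → proj₂ Fx (closed Ez (proj₁ Fx) (trans (sym G z x) a))))

-- Induced stars and paths

starRel-centre-leaf : ∀ {s j} → j < s → starRel s 0 (suc j) ≡ true
starRel-centre-leaf {s} {j} j<s rewrite T⇒≡true (<⇒<ᵇ j<s) = refl

starRel-centre-nonleaf : ∀ {s j} → ¬ j < s → starRel s 0 (suc j) ≡ false
starRel-centre-nonleaf {s} {j} j≮s rewrite ¬T⇒≡false (j≮s ∘ <ᵇ⇒< j s) = refl

induced-star : ∀ {n s} (G : Graph n) {x u : Fin n} → 1 ≤ s → adj G x u ≡ false →
  (ℓ : Fin s → Fin n) → Injective _≡_ _≡_ ℓ →
  (∀ i → adj G x (ℓ i) ≡ true) → (∀ i → adj G u (ℓ i) ≡ false) →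
  (∀ i j → adj G (ℓ i) (ℓ j) ≡ false) → InducedSub (K1s+P1 s) G
induced-star {n} {s} G {x} {u} 1≤s xu ℓ ℓ-inj xℓ uℓ ℓℓ =
  h ∘ toℕ , (λ {i} {j} e → toℕ-injective (h-injective (index≤ i) (index≤ j) e)) , λ i j → h-adj (toℕ i) (toℕ j)
  where
  -- Every argument beyond `s` gives `u`, so `h` is injective only up to `suc s`; hence `index≤`.
  h : ℕ → Fin n
  h zero = x
  h (suc j) with j <? s
  ... | yes j<s = ℓ (fromℕ< j<s)
  ... | no  _   = u
  index≤ : (i : Fin (s + 2)) → toℕ i ≤ suc s
  index≤ i = ≤-pred (≤-trans (toℕ<n i) (≤-reflexive (+-comm s 2)))
  x≢ℓ : ∀ i → x ≢ ℓ i
  x≢ℓ i e = true≢false (xℓ i) (trans (cong (adj G x) (≡.sym e)) (irrefl G x))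
  u≢ℓ : ∀ i → u ≢ ℓ i
  u≢ℓ i e = true≢false (xℓ i) (trans (cong (adj G x) (≡.sym e)) xu)
  -- A leaf tells `x` from `u`, and `1≤s` provides one.
  x≢u : x ≢ u
  x≢u e = true≢false (xℓ (fromℕ< 1≤s)) (trans (cong (λ z → adj G z (ℓ (fromℕ< 1≤s))) e) (uℓ (fromℕ< 1≤s)))
  h-injective : ∀ {a b} → a ≤ suc s → b ≤ suc s → h a ≡ h b → a ≡ b
  h-injective {zero} {zero} _ _ _ = refl
  h-injective {zero} {suc j} _ _ e with j <? s
  ... | yes j<s = contradiction e (x≢ℓ _)
  ... | no  _   = contradiction e x≢u
  h-injective {suc i} {zero} _ _ e with i <? s
  ... | yes i<s = contradiction (≡.sym e) (x≢ℓ _)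
  ... | no  _   = contradiction (≡.sym e) x≢u
  h-injective {suc i} {suc j} (s≤s i≤s) (s≤s j≤s) e with i <? s | j <? s
  ... | yes i<s | yes j<s = cong suc (fromℕ<-injective _ _ i<s j<s (ℓ-inj e))
  ... | yes i<s | no  _   = contradiction (≡.sym e) (u≢ℓ _)
  ... | no  _   | yes j<s = contradiction e (u≢ℓ _)
  ... | no i≮s  | no j≮s  = cong suc (trans (≤-antisym i≤s (≮⇒≥ i≮s)) (≤-antisym (≮⇒≥ j≮s) j≤s))
  h-adj₀ : ∀ j → adj G x (h (suc j)) ≡ starRel s 0 (suc j)
  h-adj₀ j with j <? s
  ... | yes j<s = trans (xℓ _) (≡.sym (starRel-centre-leaf j<s))
  ... | no  j≮s = trans xu (≡.sym (starRel-centre-nonleaf j≮s))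
  h-adj : ∀ a b → adj G (h a) (h b) ≡ starRel s a b
  h-adj zero    zero    = irrefl G x
  h-adj zero    (suc j) = h-adj₀ j
  h-adj (suc i) zero    = trans (sym G _ x) (trans (h-adj₀ i) (∨-identityʳ (i <ᵇ s)))
  h-adj (suc i) (suc j) with i <? s | j <? s
  ... | yes i<s | yes j<s = ℓℓ _ _
  ... | yes i<s | no  _   = trans (sym G _ u) (uℓ _)
  ... | no  _   | yes j<s = uℓ _
  ... | no  _   | no  _   = irrefl G u

pathRel-step : ∀ i → pathRel i (suc i) ≡ true
pathRel-step i rewrite T⇒≡true (≡⇒≡ᵇ i i refl) = refl

pathRel-far : ∀ {i j} → suc i < j → pathRel i j ≡ false
pathRel-far {i} {j} 1+i<j
  rewrite ¬T⇒≡false (<⇒≢ 1+i<j ∘ ≡ᵇ⇒≡ (suc i) j)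
        | ¬T⇒≡false {suc j ≡ᵇ i} (λ t → <⇒≢ (≤-trans (<⇒≤ 1+i<j) (<⇒≤ (n<1+n j))) (≡.sym (≡ᵇ⇒≡ (suc j) i t))) = refl

induced-path : ∀ {n t} (G : Graph n) (q : ℕ → Fin n) →
  (∀ {i} → suc i < t → adj G (q i) (q (suc i)) ≡ true) →
  (∀ {i j} → suc i < j → j < t → adj G (q i) (q j) ≡ false) →
  (∀ {i j} → i < j → j < t → q i ≢ q j) → InducedSub (P t) G
induced-path {n} {t} G q step far distinct = q ∘ toℕ , injective , adjacency
  where
  injective : Injective _≡_ _≡_ (q ∘ toℕ {t})
  injective {i} {j} e with <-cmp (toℕ i) (toℕ j)
  ... | tri< i<j _ _ = contradiction e (distinct i<j (toℕ<n j))
  ... | tri≈ _ i≡j _ = toℕ-injective i≡j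
  ... | tri> _ _ j<i = contradiction (≡.sym e) (distinct j<i (toℕ<n i))
  forward : ∀ {i j} → i < j → j < t → adj G (q i) (q j) ≡ pathRel i j
  forward {i} {j} i<j j<t with <-cmp (suc i) j
  ... | tri< 1+i<j _ _ = trans (far 1+i<j j<t) (≡.sym (pathRel-far 1+i<j))
  ... | tri≈ _ refl _  = trans (step j<t) (≡.sym (pathRel-step i))
  ... | tri> _ _ j<1+i = contradiction (<-≤-trans i<j (≤-pred j<1+i)) (<-irrefl refl)
  adjacency : ∀ i j → adj G (q (toℕ i)) (q (toℕ j)) ≡ adj (P t) i j
  adjacency i j with <-cmp (toℕ i) (toℕ j)
  ... | tri< i<j _ _ = forward i<j (toℕ<n j)
  ... | tri≈ _ i≡j _ rewrite toℕ-injective i≡j = trans (irrefl G _) (≡.sym (irrefl (P t) j))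
  ... | tri> _ _ j<i = trans (sym G _ _) (trans (forward j<i (toℕ<n i)) (sym (P t) j i))

-- The size bound

module Structure {n k s : ℕ} (G : Graph n) (c : Fin n → Fin k) (pr : proper G c)
                 (1≤s : 1 ≤ s) (no-star : ¬ InducedSub (K1s+P1 s) G) where

  same-colour : ∀ {x y} → c x ≡ c y → adj G x y ≡ false
  same-colour {x} {y} e = ¬-not (λ a → pr x y a e)

  NeighbourDiff : Fin n → Fin n → Fin n → Set
  NeighbourDiff x u z = adj G x z ≡ true × adj G u z ≡ false

  nonadjacent-diff : ∀ {x u} → adj G x u ≡ false → Covered (NeighbourDiff x u) (k * s)
  nonadjacent-diff {x} {u} xu = Covered-fibres c λ i → Covered-no-injection
    (λ z → ((adj G x z Bool.≟ true) ×-dec (adj G u z Bool.≟ false)) ×-dec (c z ≟ i))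
    λ ℓ ℓ-inj in-fibre → no-star (induced-star G 1≤s xu ℓ ℓ-inj
      (proj₁ ∘ proj₁ ∘ in-fibre) (proj₂ ∘ proj₁ ∘ in-fibre)
      (λ i j → same-colour (trans (proj₂ (in-fibre i)) (≡.sym (proj₂ (in-fibre j))))))

  -- A vertex seen by `x` but not by `z` is sorted by whether `y` sees it.
  diff-triangle : ∀ {x y z a b} → Covered (NeighbourDiff x y) a → Covered (NeighbourDiff y z) b →
                  Covered (NeighbourDiff x z) (a + b)
  diff-triangle {x} {y} {z} A B = Covered-⊆ split (Covered-∪ A B)
    where
    split : ∀ {w} → NeighbourDiff x z w → NeighbourDiff x y w ⊎ NeighbourDiff y z w
    split {w} (xw , zw) with adj G y w in yw
    ... | true  = inj₂ (refl , zw)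
    ... | false = inj₁ (xw , refl)

  -- Adjacency in the complement, with a loop at every vertex; loops do not change the balls.
  coR? : ∀ x y → Dec (adj G x y ≡ false)
  coR? x y = adj G x y Bool.≟ false

  module Co (v : Fin n) = Balls coR? v

  -- Any radius ≥ 2k − 1 would do: a longer geodesic has k + 1 vertices at even positions,
  -- forming a clique of G.
  ρ : ℕ
  ρ = k * 2

  -- Two of the `suc k` even positions share a colour, hence are nonadjacent in `G`. They are at
  -- least two apart, so `far` says the opposite.
  no-long-cogeodesic : ∀ v → ¬ Co.Geodesic v (suc ρ)
  no-long-cogeodesic v γ with i , j , i<j , e ← pigeonhole (n<1+n k) (λ i → c (Co.Geodesic.at γ (toℕ i * 2)))
    = Co.Geodesic.far γ (*-monoˡ-≤ 2 i<j) (m≤n⇒m≤1+n (*-monoˡ-≤ 2 (≤-pred (toℕ<n j)))) (same-colour (≡.sym e))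

  -- Components of the complement.

  module Component (v : Fin n) where

    open Co v using (Ball; Ball?; Ball-mono; Ball-closed)

    -- The component of `v` in the complement, written as a ball so that it is decidable and has
    -- bounded distances; `D-closed` shows that the ball is the whole component.
    D : Fin n → Set
    D = Ball ρ

    D? : Decidable D
    D? = Ball? ρ

    D-root : D v
    D-root = Ball-mono z≤n refl

    D-closed : ∀ {x y} → D x → adj G x y ≡ false → D y
    D-closed = Ball-closed (no-long-cogeodesic v)

    D-complete : ∀ {x y} → D x → ¬ D y → adj G x y ≡ true
    D-complete Dx ¬Dy = ¬-not (¬Dy ∘ D-closed Dx)

    -- Each step in the complement costs `k * s` by `nonadjacent-diff`. Both directions are carried
    -- along because `NeighbourDiff` is not symmetric.
    ball-diff : ∀ i {y} → Ball i y →
                Covered (NeighbourDiff v y) (i * (k * s)) × Covered (NeighbourDiff y v) (i * (k * s))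
    ball-diff zero refl = Covered-∅ (λ (p , q) → true≢false p q) , Covered-∅ (λ (p , q) → true≢false p q)
    ball-diff (suc i) (inj₁ b) with A , B ← ball-diff i b =
      Covered-mono id (m≤n+m _ _) A , Covered-mono id (m≤n+m _ _) B
    ball-diff (suc i) (inj₂ (z , b , zy)) with A , B ← ball-diff i b =
      Covered-mono id (≤-reflexive (+-comm (i * (k * s)) _)) (diff-triangle A (nonadjacent-diff zy)) ,
      diff-triangle (nonadjacent-diff (trans (sym G _ z) zy)) B

    -- The cost of going from one vertex of `D` to `v` and on to another, at most `ρ` steps each
    -- way.
    δ : ℕ
    δ = ρ * (k * s) + ρ * (k * s)

    component-diff : ∀ {x y} → D x → D y → Covered (NeighbourDiff x y) δ
    component-diff Dx Dy = diff-triangle (proj₂ (ball-diff ρ Dx)) (proj₁ (ball-diff ρ Dy))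

    -- The subgraph induced on a component.

    Edge : Fin n → Fin n → Set
    Edge x y = adj G x y ≡ true × D x × D y

    Edge? : ∀ x y → Dec (Edge x y)
    Edge? x y = (adj G x y Bool.≟ true) ×-dec (D? x ×-dec D? y)

    -- For each colour, a neighbour `w` of `x` in `D` with that colour sees no vertex of the colour,
    -- so all such neighbours of `x` are in `NeighbourDiff x w`.
    degree-bound : ∀ x → Covered (Edge x) (k * δ)
    degree-bound x = Covered-fibres c λ i → Covered-inhabited (λ z → Edge? x z ×-dec (c z ≟ i))
      λ { w ((_ , Dx , Dw) , cw) → Covered-⊆
            (λ { ((xz , _) , cz) → xz , same-colour (trans cw (≡.sym cz)) }) (component-diff Dx Dw) }

    module In = Balls Edge? v

    ball-bound : ∀ i → Covered (In.Ball i) (suc (k * δ) ^ i)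
    ball-bound zero    = cover (v ∷ []) ≤-refl here
    ball-bound (suc i) = Covered-mono id
      -- With `d` for `k * δ`, the count is `(1 + d) ^ i + (1 + d) ^ i * d`, which is
      -- `(1 + d) ^ (i + 1)`.
      (≤-reflexive (cong (suc (k * δ) ^ i +_) (*-comm (suc (k * δ) ^ i) (k * δ))))
      (Covered-∪ (ball-bound i) (Covered-⋃ (ball-bound i) degree-bound))

    In⊆D : ∀ i {x} → In.Ball i x → D x
    In⊆D zero    refl                       = D-root
    In⊆D (suc i) (inj₁ b)                   = In⊆D i b
    In⊆D (suc i) (inj₂ (_ , _ , _ , _ , Dx)) = Dx

    -- The `2 + r` vertices of such a geodesic all lie in `D`, by `level` and `In⊆D`, so an edge of
    -- `G` between two of them is an `Edge` and the path is induced in `G` itself.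
    no-long-geodesic : ∀ {r} → ¬ InducedSub (P (2 + r)) G → ¬ In.Geodesic (suc r)
    no-long-geodesic no-path γ = no-path (induced-path G at
      (λ { (s≤s i<r) → trans (sym G _ _) (proj₁ (step i<r)) })
      (λ { {i} {j} i<j (s≤s j≤r) → ¬-not λ a → far i<j j≤r
             (trans (sym G _ _) a , In⊆D _ (level j≤r) , In⊆D _ (level (≤-trans (<⇒≤ (<⇒≤ i<j)) j≤r))) })
      (λ { i<j (s≤s j≤r) → distinct i<j j≤r }))
      where open In.Geodesic γ

-- There are `k` colour classes, each inside a ball of radius `r` in a graph of degree at most
-- `k * δ`, with `δ` written out.
bound : ℕ → ℕ → ℕ → ℕ
bound k s r = k * suc (k * (k * 2 * (k * s) + k * 2 * (k * s))) ^ r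

VertexCritical-delete : ∀ {n k} {G : Graph n} → VertexCritical (suc k) G → ∀ v → Colorable (deleteVertex G v) k
VertexCritical-delete {G = G} (_ , crit) v with j , s≤s j≤k , col , _ ← crit v =
  Colorable-mono {G = deleteVertex G v} j≤k col

critical-order-bound : ∀ {n m s r} {G : Graph n} → 1 ≤ s → VertexCritical (2 + m) G →
  Free₂ (P (2 + r)) (K1s+P1 s) G → n ≤ bound (2 + m) s r
critical-order-bound {n} {m} {s} {r} {G} 1≤s crit@(((c , pr) , minimal) , _) (no-path , no-star) =
  Covered-⊤⇒≤ (Covered-fibres c λ i → Covered-inhabited (λ x → yes tt ×-dec (c x ≟ i))
    λ { v (_ , cv) → Covered-⊆ (λ { (_ , cx) → colour-class⊆ball v (trans cv (≡.sym cx)) })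
                               (Component.ball-bound v r) })
  where
  open Structure G c pr 1≤s no-star
  colour-class⊆ball : ∀ v {x} → c v ≡ c x → Component.In.Ball v r x
  colour-class⊆ball v {x} e = module-connected G D? (In.Ball? r) zero
    (minimal _ (n<1+n _)) (VertexCritical-delete crit)
    (In⊆D r) D-complete
    (λ Ex Dy a → In.Ball-closed (no-long-geodesic no-path) Ex (a , In⊆D r Ex , Dy))
    (In.Ball-mono z≤n refl) (D-closed D-root (same-colour e))
    where open Component v

-- Finiteness from a bound on the order

vectors : ∀ {A : Set} → List A → ∀ n → List (Vec A n)
vectors xs zero    = [] ∷ []
vectors xs (suc n) = cartesianProductWith _∷_ xs (vectors xs n)

∈-vectors : ∀ {A : Set} {xs : List A} → (∀ x → x ∈ xs) → ∀ {n} (v : Vec A n) → v ∈ vectors xs n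
∈-vectors all []      = here refl
∈-vectors all (x ∷ v) = ∈-cartesianProductWith⁺ _∷_ (all x) (∈-vectors all v)

-- Plain data in place of the functions and proofs inside a `Graph`: every matrix is provably
-- listed, and `Iso` asks only for entrywise agreement of adjacencies.
Matrix : ℕ → Set
Matrix n = Vec (Vec Bool n) n

matrices : ∀ n → List (Matrix n)
matrices n = vectors (vectors (true ∷ false ∷ []) n) n

∈-matrices : ∀ {n} (M : Matrix n) → M ∈ matrices n
∈-matrices = ∈-vectors (∈-vectors λ { true → here refl ; false → there (here refl) })

entry : ∀ {n} → Matrix n → Fin n → Fin n → Bool
entry M i j = Vec.lookup (Vec.lookup M i) j

-- Arbitrary matrices are symmetrised and lose their diagonal; adjacency matrices are unchanged.
fromMatrix : ∀ {n} → Matrix n → Graph n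
fromMatrix M = record
  { adj    = λ i j → (entry M i j ∧ entry M j i) ∧ not (does (i ≟ j))
  ; sym    = λ i j → cong₂ _∧_ (∧-comm (entry M i j) _) (cong not (does-≟-sym i j))
  ; irrefl = λ i → trans (cong (λ b → (entry M i i ∧ entry M i i) ∧ not b) (dec-true (i ≟ i) refl)) (∧-zeroʳ _)
  }
  where
  does-≟-sym : ∀ {n} (i j : Fin n) → does (i ≟ j) ≡ does (j ≟ i)
  does-≟-sym i j with i ≟ j
  ... | yes p = ≡.sym (dec-true (j ≟ i) (≡.sym p))
  ... | no ¬p = ≡.sym (dec-false (j ≟ i) (¬p ∘ ≡.sym))

toMatrix : ∀ {n} → Graph n → Matrix n
toMatrix G = Vec.tabulate λ i → Vec.tabulate (adj G i)

entry-toMatrix : ∀ {n} (G : Graph n) i j → entry (toMatrix G) i j ≡ adj G i j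
entry-toMatrix G i j = trans (cong (λ v → Vec.lookup v j) (lookup∘tabulate _ i)) (lookup∘tabulate (adj G i) j)

adj-fromMatrix-toMatrix : ∀ {n} (G : Graph n) i j → adj (fromMatrix (toMatrix G)) i j ≡ adj G i j
adj-fromMatrix-toMatrix G i j rewrite entry-toMatrix G i j | entry-toMatrix G j i | sym G j i
  | ∧-idem (adj G i j) with i ≟ j
... | yes refl = trans (∧-zeroʳ _) (≡.sym (irrefl G i))
... | no  _    = ∧-identityʳ _

graphsOfOrder : ℕ → List AnyGraph
graphsOfOrder n = map (λ M → n , fromMatrix M) (matrices n)

-- The list may contain graphs outside `𝒞`: only a copy of each member is required, so all orders up
-- to `N` are enumerated.
bounded-order⇒finite : (𝒞 : ∀ {n} → Graph n → Set) (N : ℕ) →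
  (∀ {n} (G : Graph n) → 𝒞 G → n ≤ N) → FinitelyManyUpToIso 𝒞
bounded-order⇒finite 𝒞 N order≤ = concatMap graphsOfOrder (upTo (suc N)) , λ {n} G G∈𝒞 →
  (n , fromMatrix (toMatrix G)) ,
  ∈-concatMap⁺ graphsOfOrder (lose (∈-upTo⁺ (s≤s (order≤ G G∈𝒞)))
                                   (∈-map⁺ (λ M → n , fromMatrix M) (∈-matrices (toMatrix G)))) ,
  ↔-id _ , adj-fromMatrix-toMatrix G

theorem3 : (s : ℕ) → 1 ≤ s →
    FinitelyManyUpToIso (λ G → VertexCritical 5 G × Free₂ (P 5) (K1s+P1 s) G)
-- Both fives are read as `2 + 3`: five colours give `m = 3`, and the path on five vertices gives
-- radius `r = 3`.
theorem3 s 1≤s = bounded-order⇒finite (λ G → VertexCritical 5 G × Free₂ (P 5) (K1s+P1 s) G) (bound 5 s 3)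
  λ _ (crit , free) → critical-order-bound 1≤s crit free
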